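{- Let $p$ be an odd prime, let $A, B$ be integers, and let $\Delta = A^2 + 4B$. If $\Delta$ is a non-zero quadratic residue modulo $p$ (that is, $\Delta \not\equiv 0 \pmod p$ and $\Delta$ is congruent to a square modulo $p$), then $k_{A,B}(p)$ divides $p-1$. In particular, $k_{A,B}(p) \le p-1$.
   Context: For integers $A, B$, let $(E_n)_{n \ge 0}$ be the sequence defined by $E_0 = 0$, $E_1 = 1$ and $E_{n+1} = A E_n + B E_{n-1}$ for $n \ge 1$. For a prime $p$, $k_{A,B}(p)$ denotes the period of the sequence $(E_n)$ modulo $p$, where, as for the Fibonacci sequence (the case $A = B = 1$), the period is the smallest positive index $i$ such that $E_i \equiv 0 \pmod p$ and $E_{i+1} \equiv 1 \pmod p$. -}

module Defs where

open import Data.Fin.Base using (Fin; toℕ; fromℕ<; combine)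
open import Data.Fin.Properties using (pigeonhole; fromℕ<-injective; combine-injective)
open import Data.Integer.Base using (ℤ; +_; 0ℤ; 1ℤ; _+_; _*_; _-_; ∣_∣)
import Data.Integer.Base as ℤ
open import Data.Integer.DivMod using (_%ℕ_; _/ℕ_; n%ℕd<d; a≡a%ℕn+[a/ℕn]*n)
open import Data.Integer.Divisibility.Signed
  using (_∣_; divides; _∣?_; ∣ᵤ⇒∣; ∣⇒∣ᵤ; ∣m∣n⇒∣m-n; ∣m⇒∣-m; ∣n⇒∣m*n)
open import Data.Integer.Properties using (abs-*)
open import Data.Integer.Tactic.RingSolver using (solve-∀)
open import Data.Nat.Base as ℕ using (ℕ; zero; suc; _≤_; _<_; z≤n; s≤s; z<s; s<s)
import Data.Nat.Properties as ℕ
open import Data.Nat.Primality using (Prime; euclidsLemma; prime⇒nonZero)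
open import Data.Product.Base using (_×_; _,_; ∃)
open import Data.Sum.Base using (_⊎_; inj₁; inj₂)
open import Relation.Binary.PropositionalEquality
  using (_≡_; refl; sym; trans; cong; subst)
open import Relation.Nullary.Decidable using (Dec; yes; no; _×-dec_)
open import Relation.Nullary.Negation using (¬_; contradiction)

infix 4 _≡_[mod_]

_≡_[mod_] : ℤ → ℤ → ℕ → Set
a ≡ b [mod n ] = + n ∣ a - b

E : (A B : ℤ) → ℕ → ℤ
E A B zero          = 0ℤ
E A B (suc zero)    = 1ℤ
E A B (suc (suc n)) = A * E A B (suc n) + B * E A B n

Δ : (A B : ℤ) → ℤ
Δ A B = A * A + + 4 * B

NonzeroQuadraticResidue : ℤ → ℕ → Set
NonzeroQuadraticResidue a p =
  ¬ (a ≡ 0ℤ [mod p ]) × ∃ λ x → a ≡ x * x [mod p ]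

IsReturn : (A B : ℤ) (p i : ℕ) → Set
IsReturn A B p i =
  0 < i × E A B i ≡ 0ℤ [mod p ] × E A B (suc i) ≡ 1ℤ [mod p ]

-- k_{A,B}(p) is a relation rather than a function, because the period need not
-- exist when p ∣ B: if B ≡ 0 and A ≢ 0, then Eₙ ≡ Aⁿ⁻¹ ≢ 0 for every n ≥ 1.
-- It is unique by antisymmetry of ≤, and exists whenever p ∤ B (period-exists).
IsPeriod : (A B : ℤ) (p k : ℕ) → Set
IsPeriod A B p k = IsReturn A B p k × (∀ i → IsReturn A B p i → k ≤ i)

private
  module _ (P : ℕ → Set) (P? : ∀ n → Dec (P n)) where

    Least : Set
    Least = ∃ λ k → P k × (∀ i → P i → k ≤ i)

    search : ∀ n → Least ⊎ (∀ i → i < n → ¬ P i)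
    search zero = inj₂ λ _ ()
    search (suc n) with search n
    ... | inj₁ l = inj₁ l
    ... | inj₂ none with P? n
    ...   | yes pn = inj₁ (n , pn , λ i pi → ℕ.≮⇒≥ (λ i<n → none i i<n pi))
    ...   | no ¬pn = inj₂ below
      where
      below : ∀ i → i < suc n → ¬ P i
      below i (s≤s i≤n) with ℕ.m≤n⇒m<n∨m≡n i≤n
      ... | inj₁ i<n  = none i i<n
      ... | inj₂ refl = ¬pn

    least : ∃ P → Least
    least (n , pn) with search (suc n)
    ... | inj₁ l    = l
    ... | inj₂ none = contradiction pn (none n ℕ.≤-refl)

  isReturn? : ∀ A B p i → Dec (IsReturn A B p i)
  isReturn? A B p i =
    (0 ℕ.<? i) ×-dec (+ p ∣? E A B i - 0ℤ) ×-dec (+ p ∣? E A B (suc i) - 1ℤ)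

  mod-sym : ∀ a b {n} → a ≡ b [mod n ] → b ≡ a [mod n ]
  mod-sym a b h = subst (_ ∣_) (lem a b) (∣m⇒∣-m h)
    where
    lem : ∀ a b → ℤ.- (a - b) ≡ b - a
    lem = solve-∀

  %-≡⇒≡mod : ∀ a b n .{{_ : ℕ.NonZero n}} → a %ℕ n ≡ b %ℕ n → a ≡ b [mod n ]
  %-≡⇒≡mod a b n eq = subst (+ n ∣_) (sym step)
    (divides ((a /ℕ n) - (b /ℕ n)) (lem (+ (b %ℕ n)) (a /ℕ n) (b /ℕ n) (+ n)))
    where
    lem : ∀ r u v m → (r + u * m) - (r + v * m) ≡ (u - v) * m
    lem = solve-∀
    ea : a ≡ + (b %ℕ n) + (a /ℕ n) * + n
    ea = trans (a≡a%ℕn+[a/ℕn]*n a n) (cong (λ r → + r + (a /ℕ n) * + n) eq)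
    step : a - b ≡ (+ (b %ℕ n) + (a /ℕ n) * + n) - (+ (b %ℕ n) + (b /ℕ n) * + n)
    step = trans (cong (_- b) ea)
      (cong (λ z → (+ (b %ℕ n) + (a /ℕ n) * + n) - z) (a≡a%ℕn+[a/ℕn]*n b n))

  module _ (A B : ℤ) {p : ℕ} (pp : Prime p) (p∤B : ¬ (+ p ∣ B)) where

    cancel-B : ∀ {z} → + p ∣ B * z → + p ∣ z
    cancel-B {z} h
      with euclidsLemma ∣ B ∣ ∣ z ∣ pp (subst (p ∣ℕ_) (abs-* B z) (∣⇒∣ᵤ h))
      where open import Data.Nat.Divisibility using () renaming (_∣_ to _∣ℕ_)
    ... | inj₁ p∣B = contradiction (∣ᵤ⇒∣ p∣B) p∤B
    ... | inj₂ p∣z = ∣ᵤ⇒∣ p∣z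

    descend : ∀ i j → i < j →
      E A B i ≡ E A B j [mod p ] → E A B (suc i) ≡ E A B (suc j) [mod p ] →
      ∃ (IsReturn A B p)
    descend zero    j       0<j       h₀ h₁ =
      j , 0<j , mod-sym 0ℤ (E A B j) h₀ , mod-sym 1ℤ (E A B (suc j)) h₁
    descend (suc i) (suc j) (s<s i<j) h₁ h₂ =
      descend i j i<j
        (cancel-B (subst (+ p ∣_)
          (lem A B (E A B (suc i)) (E A B (suc j)) (E A B i) (E A B j))
          (∣m∣n⇒∣m-n h₂ (∣n⇒∣m*n A h₁))))
        h₁
      where
      lem : ∀ A B x y z w →
        ((A * x + B * z) - (A * y + B * w)) - A * (x - y) ≡ B * (z - w)
      lem = solve-∀

    return-exists : ∃ (IsReturn A B p)
    return-exists = go (pigeonhole (ℕ.n<1+n (p ℕ.* p)) pair)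
      where
      instance _ = prime⇒nonZero pp
      residue : ℕ → Fin p
      residue n = fromℕ< (n%ℕd<d (E A B n) p)
      pair : Fin (suc (p ℕ.* p)) → Fin (p ℕ.* p)
      pair i = combine (residue (toℕ i)) (residue (suc (toℕ i)))
      residue⇒mod : ∀ m n → residue m ≡ residue n → E A B m ≡ E A B n [mod p ]
      residue⇒mod m n eq = %-≡⇒≡mod (E A B m) (E A B n) p (fromℕ<-injective _ _ _ _ eq)
      go : (∃ λ i → ∃ λ j → toℕ i < toℕ j × pair i ≡ pair j) → ∃ (IsReturn A B p)
      go (i , j , i<j , eq) =
        let eq₀ , eq₁ = combine-injective
                          (residue (toℕ i)) (residue (suc (toℕ i)))
                          (residue (toℕ j)) (residue (suc (toℕ j))) eq
        in descend (toℕ i) (toℕ j) i<j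
             (residue⇒mod (toℕ i) (toℕ j) eq₀)
             (residue⇒mod (suc (toℕ i)) (suc (toℕ j)) eq₁)

period-exists : ∀ A B {p} → Prime p → ¬ (+ p ∣ B) → ∃ (IsPeriod A B p)
period-exists A B {p} pp p∤B =
  least (IsReturn A B p) (isReturn? A B p) (return-exists A B pp p∤B)

{-# OPTIONS --safe #-}

-- If Δ ≡ x² then A + x and A - x are twice the roots of the characteristic
-- polynomial t² - A t - B, so Binet's formula modulo p reads
--   (A + x)ⁿ - (A - x)ⁿ ≡ 2ⁿ x Eₙ.
-- The return index k forces p ∤ B, so A + x and A - x are invertible, and by Fermat's
-- little theorem n = p - 1 and n = p give E_{p-1} ≡ 0 and E_p ≡ 1.  Since E is
-- k-periodic, (p - 1) mod k would be a smaller return index unless it is 0.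
module Submission where

open import Defs
open import Algebra.Bundles using (CommutativeSemiring; CommutativeRing)
open import Data.Fin.Base using (zero; suc; toℕ; fromℕ; inject₁)
open import Data.Fin.Properties using (toℕ-fromℕ; toℕ-inject₁; toℕ<n)
open import Data.Integer.Base using (ℤ; +_; 0ℤ; 1ℤ; ∣_∣)
import Data.Integer.Base as ℤ
open import Data.Integer.DivMod using (_%ℕ_; _/ℕ_; a≡a%ℕn+[a/ℕn]*n)
import Data.Integer.Divisibility.Signed as ℤ∣
import Data.Integer.Properties as ℤ
open import Data.Integer.Tactic.RingSolver using (solve-∀)
open import Data.Nat.Base as ℕ using (ℕ; zero; suc; _∸_; _≤_; _<_; z<s; s<s; _!)
open import Data.Nat.Combinatorics using (_C_; nCk≡n!/k![n-k]!; k![n∸k]!∣n!; nCn≡1)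
open import Data.Nat.Divisibility using (_∣_; divides; ∣⇒≤; ∣1⇒≡1; m∣m*n; m%n≡0⇒n∣m)
open import Data.Nat.DivMod using (_%_; _/_; m/n*n≡m; m≡m%n+[m/n]*n; m%n<n)
open import Data.Nat.Primality
  using (Prime; prime[2]; euclidsLemma; prime⇒nonZero; prime⇒irreducible; ¬prime[0]; ¬prime[1])
import Data.Nat.Properties as ℕ
open import Data.Product.Base using (_×_; _,_)
open import Data.Sum.Base using (_⊎_; inj₁; inj₂)
import Data.Sum.Base as Sum
open import Level using (0ℓ)
open import Relation.Binary.PropositionalEquality
  using (_≡_; refl; sym; trans; cong; subst)
open import Relation.Nullary.Negation using (¬_; contradiction)

-- Prime divisors of factorials and binomial coefficients.

prime∤1 : ∀ {p} → Prime p → ¬ p ∣ 1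
prime∤1 p-prime p∣1 = ¬prime[1] (subst Prime (∣1⇒≡1 p∣1) p-prime)

prime∤k! : ∀ {p k} → Prime p → k < p → ¬ p ∣ k !
prime∤k! {k = zero}  p-prime _   p∣1 = prime∤1 p-prime p∣1
prime∤k! {k = suc k} p-prime k<p p∣k! with euclidsLemma (suc k) (k !) p-prime p∣k!
... | inj₁ p∣k      = ℕ.<⇒≱ k<p (∣⇒≤ p∣k)
... | inj₂ p∣[k-1]! = prime∤k! p-prime (ℕ.<-trans (ℕ.n<1+n k) k<p) p∣[k-1]!

-- `p` divides `p !`, which is `p C k` times `k ! * (p ∸ k) !`, and both factorials are products of
-- positive numbers below `p`.
prime∣nCk : ∀ {p k} → Prime p → 0 < k → k < p → p ∣ p C k
prime∣nCk {p@(suc q)} {k@(suc _)} p-prime 0<k k<p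
  with euclidsLemma (p C k) (k ! ℕ.* (p ∸ k) !) p-prime
         (subst (p ∣_) (sym C*d≡p!) (m∣m*n (q !)))
  where
  instance _ = k ℕ.!* (p ∸ k) !≢0
  C*d≡p! : (p C k) ℕ.* (k ! ℕ.* (p ∸ k) !) ≡ p !
  C*d≡p! = trans (cong (ℕ._* (k ! ℕ.* (p ∸ k) !)) (nCk≡n!/k![n-k]! (ℕ.<⇒≤ k<p)))
                 (m/n*n≡m (k![n∸k]!∣n! (ℕ.<⇒≤ k<p)))
... | inj₁ p∣C = p∣C
... | inj₂ p∣d with euclidsLemma (k !) ((p ∸ k) !) p-prime p∣d
...   | inj₁ p∣k!     = contradiction p∣k! (prime∤k! p-prime k<p)
...   | inj₂ p∣[p-k]! =
        contradiction p∣[p-k]! (prime∤k! p-prime (ℕ.∸-monoʳ-< 0<k (ℕ.<⇒≤ k<p)))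

-- The Frobenius map and Fermat's little theorem in characteristic p.

module PrimeCharacteristic {c ℓ} (S : CommutativeSemiring c ℓ) where

  open CommutativeSemiring S hiding (zero) renaming (refl to ≈-refl; sym to ≈-sym; trans to ≈-trans)
  open import Algebra.Properties.Semiring.Exp semiring
  open import Algebra.Properties.Semiring.Mult semiring renaming (_×_ to _·_)
  open import Algebra.Properties.Semiring.Sum semiring
  open import Algebra.Properties.CommutativeSemiring.Binomial S renaming (theorem to binomial-theorem)
  open import Relation.Binary.Reasoning.Setoid setoid

  module _ {p} (p-prime : Prime p) (p·1≈0 : p · 1# ≈ 0#) where

    -- Since `m · x` equals `(m · 1#) * x`, the vanishing of `p · 1#` spreads to every `x`.
    multiple-vanishes : ∀ {m} → p ∣ m → ∀ x → m · x ≈ 0#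
    multiple-vanishes {m} (divides q refl) x = begin
      (q ℕ.* p) · x          ≈⟨ ×-congʳ (q ℕ.* p) (*-identityˡ x) ⟨
      (q ℕ.* p) · (1# * x)   ≈⟨ ×-assoc-* (q ℕ.* p) 1# x ⟨
      (q ℕ.* p) · 1# * x     ≈⟨ *-congʳ (×-assocˡ 1# q p) ⟨
      q · (p · 1#) * x       ≈⟨ *-congʳ (×-congʳ q p·1≈0) ⟩
      q · 0# * x             ≈⟨ ×-assoc-* q 0# x ⟩
      q · (0# * x)           ≈⟨ ×-comm-* q 0# x ⟨
      0# * (q · x)           ≈⟨ zeroˡ _ ⟩
      0#                     ∎

    -- Only the two outer terms of the binomial expansion survive, since `p` divides every
    -- coefficient strictly between them.
    frobenius-+ : ∀ x y → (x + y) ^ p ≈ x ^ p + y ^ p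
    frobenius-+ x y = expand p refl
      where
      -- A separate exponent `n`, equal to the module parameter `p`, allows a case split; `suc q`
      -- exposes the outer terms of the sum.
      expand : ∀ n → n ≡ p → (x + y) ^ n ≈ x ^ n + y ^ n
      expand zero    refl = contradiction p-prime ¬prime[0]
      expand (suc q) refl = begin
        (x + y) ^ p                                    ≈⟨ binomial-theorem p x y ⟩
        t zero + sum (λ i → t (suc i))                 ≈⟨ +-cong first (sum-init-last (λ i → t (suc i))) ⟩
        y ^ p + (sum middle + t (suc (fromℕ q)))       ≈⟨ +-congˡ (+-cong middle≈0 last) ⟩
        y ^ p + (0# + x ^ p)                           ≈⟨ +-congˡ (+-identityˡ _) ⟩
        y ^ p + x ^ p                                  ≈⟨ +-comm _ _ ⟩
        x ^ p + y ^ p                                  ∎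
        where
        t = binomialTerm x y p
        middle = λ i → t (suc (inject₁ i))
        first : t zero ≈ y ^ p
        first = ≈-trans (+-identityʳ _) (*-identityˡ _)
        middle≈0 : sum middle ≈ 0#
        middle≈0 = ≈-trans
          (sum-cong-≋ λ i → multiple-vanishes
            (prime∣nCk p-prime z<s
              (s<s (subst (_< q) (sym (toℕ-inject₁ i)) (toℕ<n i)))) _)
          (sum-replicate-zero q)
        last : t (suc (fromℕ q)) ≈ x ^ p
        -- At the top index the coefficient becomes 1 and the exponent of `y` becomes 0.
        last rewrite toℕ-fromℕ q | nCn≡1 (suc q) | ℕ.n∸n≡0 q =
          ≈-trans (+-identityʳ _) (*-identityʳ _)

    -- Induction on `n`: by additivity of the p-th power, the elements it fixes are closed under
    -- adding `1#`.
    fermat-· : ∀ n → (n · 1#) ^ p ≈ n · 1#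
    -- The base case needs `p` non-zero, since `0# ^ 0` is `1#`.
    fermat-· zero = 0^ p (prime⇒nonZero p-prime)
      where
      0^ : ∀ n → ℕ.NonZero n → 0# ^ n ≈ 0#
      0^ (suc n) _ = zeroˡ _
    fermat-· (suc n) = ≈-trans (frobenius-+ 1# (n · 1#))
      (+-cong (1^ p) (fermat-· n))
      where
      1^ : ∀ n → 1# ^ n ≈ 1#
      1^ zero    = ≈-refl
      1^ (suc n) = ≈-trans (*-identityˡ _) (1^ n)

-- The ring of integers modulo n.

module _ (n : ℕ) where

  -- A record, so that the two sides can be inferred from a proof.
  record Congruent (a b : ℤ) : Set where
    constructor congruent
    field difference : a ≡ b [mod n ]

  -- The quotient is taken as a setoid: the carrier stays `ℤ`, so ring laws and solver identities of
  -- `ℤ` transfer through `reflexive`.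
  ℤ/ : CommutativeRing 0ℓ 0ℓ
  ℤ/ = record
    { Carrier = ℤ
    ; _≈_ = Congruent
    ; _+_ = ℤ._+_
    ; _*_ = ℤ._*_
    ; -_  = ℤ.-_
    ; 0#  = 0ℤ
    ; 1#  = 1ℤ
    ; isCommutativeRing = record
      { isRing = record
        { +-isAbelianGroup = record
          { isGroup = record
            { isMonoid = record
              { isSemigroup = record
                { isMagma = record
                  { isEquivalence = record { refl = reflexive refl ; sym = ≈-sym ; trans = ≈-trans }
                  ; ∙-cong = +-cong }
                ; assoc = λ x y z → reflexive (ℤ.+-assoc x y z) }
              ; identity = (λ x → reflexive (ℤ.+-identityˡ x)) , (λ x → reflexive (ℤ.+-identityʳ x)) }
            ; inverse = (λ x → reflexive (ℤ.+-inverseˡ x)) , (λ x → reflexive (ℤ.+-inverseʳ x))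
            ; ⁻¹-cong = neg-cong }
          ; comm = λ x y → reflexive (ℤ.+-comm x y) }
        ; *-cong = *-cong
        ; *-assoc = λ x y z → reflexive (ℤ.*-assoc x y z)
        ; *-identity = (λ x → reflexive (ℤ.*-identityˡ x)) , (λ x → reflexive (ℤ.*-identityʳ x))
        ; distrib = (λ x y z → reflexive (ℤ.*-distribˡ-+ x y z))
                  , (λ x y z → reflexive (ℤ.*-distribʳ-+ x y z)) }
      ; *-comm = λ x y → reflexive (ℤ.*-comm x y) } }
    where
    reflexive : ∀ {a b} → a ≡ b → Congruent a b
    reflexive {a} refl = congruent (ℤ∣.divides 0ℤ (ℤ.+-inverseʳ a))

    ≈-sym : ∀ {a b} → Congruent a b → Congruent b a
    ≈-sym {a} {b} (congruent h) = congruent (subst (+ n ℤ∣.∣_) (lem a b) (ℤ∣.∣m⇒∣-m h))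
      where
      lem : ∀ a b → ℤ.- (a ℤ.- b) ≡ b ℤ.- a
      lem = solve-∀

    ≈-trans : ∀ {a b c} → Congruent a b → Congruent b c → Congruent a c
    ≈-trans {a} {b} {c} (congruent h) (congruent h′) =
      congruent (subst (+ n ℤ∣.∣_) (lem a b c) (ℤ∣.∣m∣n⇒∣m+n h h′))
      where
      lem : ∀ a b c → (a ℤ.- b) ℤ.+ (b ℤ.- c) ≡ a ℤ.- c
      lem = solve-∀

    +-cong : ∀ {a b c d} → Congruent a b → Congruent c d → Congruent (a ℤ.+ c) (b ℤ.+ d)
    +-cong {a} {b} {c} {d} (congruent h) (congruent h′) =
      congruent (subst (+ n ℤ∣.∣_) (lem a b c d) (ℤ∣.∣m∣n⇒∣m+n h h′))
      where
      lem : ∀ a b c d → (a ℤ.- b) ℤ.+ (c ℤ.- d) ≡ (a ℤ.+ c) ℤ.- (b ℤ.+ d)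
      lem = solve-∀

    *-cong : ∀ {a b c d} → Congruent a b → Congruent c d → Congruent (a ℤ.* c) (b ℤ.* d)
    *-cong {a} {b} {c} {d} (congruent h) (congruent h′) =
      congruent (subst (+ n ℤ∣.∣_) (lem a b c d)
        (ℤ∣.∣m∣n⇒∣m+n (ℤ∣.∣n⇒∣m*n c h) (ℤ∣.∣n⇒∣m*n b h′)))
      where
      lem : ∀ a b c d → c ℤ.* (a ℤ.- b) ℤ.+ b ℤ.* (c ℤ.- d) ≡ a ℤ.* c ℤ.- b ℤ.* d
      lem = solve-∀

    neg-cong : ∀ {a b} → Congruent a b → Congruent (ℤ.- a) (ℤ.- b)
    neg-cong {a} {b} (congruent h) = congruent (subst (+ n ℤ∣.∣_) (lem a b) (ℤ∣.∣m⇒∣-m h))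
      where
      lem : ∀ a b → ℤ.- (a ℤ.- b) ≡ ℤ.- a ℤ.- ℤ.- b
      lem = solve-∀

-- Integers modulo a prime: cancellation and Fermat's little theorem.

module _ {p : ℕ} (p-prime : Prime p) where

  open CommutativeRing (ℤ/ p) hiding (zero) renaming (refl to ≈-refl; sym to ≈-sym; trans to ≈-trans)
  open import Algebra.Properties.Semiring.Exp semiring
  open import Algebra.Properties.Semiring.Mult semiring using () renaming (_×_ to _·_)
  open import Algebra.Properties.Group +-group
    using () renaming (x≈y⇒x∙y⁻¹≈ε to x≈y⇒x-y≈0; x∙y⁻¹≈ε⇒x≈y to x-y≈0⇒x≈y)
  open import Relation.Binary.Reasoning.Setoid setoid
  open PrimeCharacteristic commutativeSemiring using (fermat-·)

  ∣⇒≈0 : ∀ {a} → + p ℤ∣.∣ a → a ≈ 0#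
  ∣⇒≈0 {a} h = congruent (subst (+ p ℤ∣.∣_) (sym (ℤ.+-identityʳ a)) h)

  ≈0⇒∣ : ∀ {a} → a ≈ 0# → + p ℤ∣.∣ a
  ≈0⇒∣ {a} (congruent h) = subst (+ p ℤ∣.∣_) (ℤ.+-identityʳ a) h

  zero-product : ∀ a b → a * b ≈ 0# → a ≈ 0# ⊎ b ≈ 0#
  zero-product a b ab≈0 =
    Sum.map (λ h → ∣⇒≈0 (ℤ∣.∣ᵤ⇒∣ h)) (λ h → ∣⇒≈0 (ℤ∣.∣ᵤ⇒∣ h))
      (euclidsLemma ∣ a ∣ ∣ b ∣ p-prime
        (subst (p ∣_) (ℤ.abs-* a b) (ℤ∣.∣⇒∣ᵤ (≈0⇒∣ ab≈0))))

  -- Modulo a prime there are no zero divisors, so `a * (b - c) ≈ 0#` forces `b - c ≈ 0#`.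
  *-cancelˡ-≉0 : ∀ a b c → ¬ a ≈ 0# → a * b ≈ a * c → b ≈ c
  *-cancelˡ-≉0 a b c a≉0 ab≈ac =
    Sum.[ (λ a≈0 → contradiction a≈0 a≉0) , x-y≈0⇒x≈y b c ]′
      (zero-product a (b - c) a[b-c]≈0)
    where
    lem : ∀ a b c → a ℤ.* (b ℤ.- c) ≡ a ℤ.* b ℤ.- a ℤ.* c
    lem = solve-∀
    a[b-c]≈0 : a * (b - c) ≈ 0#
    a[b-c]≈0 = ≈-trans (reflexive (lem a b c)) (x≈y⇒x-y≈0 {a * b} {a * c} ab≈ac)

  1≉0 : ¬ 1# ≈ 0#
  1≉0 1≈0 = prime∤1 p-prime (ℤ∣.∣⇒∣ᵤ (≈0⇒∣ 1≈0))

  n·1≡n : ∀ n → n · 1# ≡ + n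
  n·1≡n zero    = refl
  n·1≡n (suc n) = cong ℤ.suc (n·1≡n n)

  -- Every integer is congruent to its remainder, a natural multiple of `1#`, to which `fermat-·`
  -- applies.
  fermat : ∀ a → a ^ p ≈ a
  fermat a = begin
    a ^ p         ≈⟨ ^-congˡ p a≈r ⟩
    (r · 1#) ^ p  ≈⟨ fermat-· p-prime p·1≈0 r ⟩
    r · 1#        ≈⟨ a≈r ⟨
    a             ∎
    where
    instance _ = prime⇒nonZero p-prime
    r = a %ℕ p
    q = a /ℕ p
    p·1≈0 : p · 1# ≈ 0#
    p·1≈0 = ≈-trans (reflexive (n·1≡n p)) (∣⇒≈0 ℤ∣.∣-refl)
    a≈r : a ≈ r · 1#
    a≈r = begin
      a               ≡⟨ a≡a%ℕn+[a/ℕn]*n a p ⟩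
      + r + q * + p   ≈⟨ +-congˡ {+ r} (∣⇒≈0 {q * + p} (ℤ∣.∣n⇒∣m*n q ℤ∣.∣-refl)) ⟩
      + r + 0#        ≈⟨ +-identityʳ (+ r) ⟩
      + r             ≡⟨ n·1≡n r ⟨
      r · 1#          ∎

  -- One factor `a` is cancelled from `a ^ p ≈ a`.
  fermat-unit : ∀ {a m} → p ≡ suc m → ¬ a ≈ 0# → a ^ m ≈ 1#
  fermat-unit {a} {m} refl a≉0 =
    *-cancelˡ-≉0 a (a ^ m) 1# a≉0 (≈-trans (fermat a) (≈-sym (*-identityʳ a)))

  -- Periodicity of the sequence modulo p.

  module _ (A B : ℤ) where

    module _ {k : ℕ} (Eₖ≈0 : E A B k ≈ 0#) (Eₖ₊₁≈1 : E A B (suc k) ≈ 1#) where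

      -- The recurrence has order two, so once the pair at `k` repeats the initial pair, all later
      -- terms repeat.
      E-periodic : ∀ n → E A B (n ℕ.+ k) ≈ E A B n
      E-periodic zero          = Eₖ≈0
      E-periodic (suc zero)    = Eₖ₊₁≈1
      E-periodic (suc (suc n)) =
        +-cong (*-congˡ {A} (E-periodic (suc n))) (*-congˡ {B} (E-periodic n))

      E-periodic-* : ∀ q n → E A B (n ℕ.+ q ℕ.* k) ≈ E A B n
      E-periodic-* zero    n = reflexive (cong (E A B) (ℕ.+-identityʳ n))
      E-periodic-* (suc q) n = begin
        E A B (n ℕ.+ (k ℕ.+ q ℕ.* k))  ≡⟨ cong (E A B) (ℕ.+-assoc n k (q ℕ.* k)) ⟨
        E A B (n ℕ.+ k ℕ.+ q ℕ.* k)    ≈⟨ E-periodic-* q (n ℕ.+ k) ⟩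
        E A B (n ℕ.+ k)                ≈⟨ E-periodic n ⟩
        E A B n                        ∎

    period-divides : ∀ {k} → IsPeriod A B p k → ∀ m →
      E A B m ≈ 0# → E A B (suc m) ≈ 1# → k ∣ m
    -- `IsReturn` contains `0 < k`, so only a successor can occur, and `m % k` is defined.
    period-divides {k@(suc _)} ((_ , Eₖ≡0 , Eₖ₊₁≡1) , least) m Eₘ≈0 Eₘ₊₁≈1 =
      m%n≡0⇒n∣m m k (ℕ.n≤0⇒n≡0 (ℕ.≮⇒≥ λ 0<r →
        ℕ.<⇒≱ (m%n<n m k) (least r (remainder-return 0<r))))
      where
      r = m % k
      -- The shifts `j = 0` and `j = 1` supply the two congruences that make a positive `r` a return
      -- index.
      E[j+r]≈E[j+m] : ∀ j → E A B (j ℕ.+ r) ≈ E A B (j ℕ.+ m)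
      E[j+r]≈E[j+m] j = begin
        E A B (j ℕ.+ r)                        ≈⟨ E-periodic-* {k} (congruent Eₖ≡0) (congruent Eₖ₊₁≡1) (m / k) (j ℕ.+ r) ⟨
        E A B (j ℕ.+ r ℕ.+ (m / k) ℕ.* k)      ≡⟨ cong (E A B) (ℕ.+-assoc j r ((m / k) ℕ.* k)) ⟩
        E A B (j ℕ.+ (r ℕ.+ (m / k) ℕ.* k))    ≡⟨ cong (λ i → E A B (j ℕ.+ i)) (m≡m%n+[m/n]*n m k) ⟨
        E A B (j ℕ.+ m)                        ∎
      remainder-return : 0 < r → IsReturn A B p r
      remainder-return 0<r =
          0<r
        , Congruent.difference (≈-trans (E[j+r]≈E[j+m] 0) Eₘ≈0)
        , Congruent.difference (≈-trans (E[j+r]≈E[j+m] 1) Eₘ₊₁≈1)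

    -- With `B ≈ 0#`, the term after the return index is congruent to `A` times a vanishing term, so
    -- it could not be congruent to 1.
    return⇒B≉0 : ∀ {k} → IsReturn A B p k → ¬ B ≈ 0#
    return⇒B≉0 {suc k} (_ , Eₖ≡0 , Eₖ₊₁≡1) B≈0 = 1≉0 (begin
      1#                                ≈⟨ congruent Eₖ₊₁≡1 ⟨
      A * E A B (suc k) + B * E A B k   ≈⟨ +-cong (*-congˡ {A} (congruent Eₖ≡0)) (*-congʳ {E A B k} B≈0) ⟩
      A * 0# + 0# * E A B k             ≈⟨ +-cong (zeroʳ A) (zeroˡ (E A B k)) ⟩
      0# + 0#                           ≈⟨ +-identityˡ 0# ⟩
      0#                                ∎)

    -- Binet's formula modulo p and the terms at p - 1 and p.

    module _ (x : ℤ) (Δ≈x² : Δ A B ≈ x * x) where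

      4B≈x²-A² : + 4 * B ≈ x * x - A * A
      4B≈x²-A² = begin
        + 4 * B          ≡⟨ lem (A * A) (+ 4 * B) ⟩
        Δ A B - A * A    ≈⟨ +-congʳ { - (A * A)} Δ≈x² ⟩
        x * x - A * A    ∎
        where
        lem : ∀ s t → t ≡ s ℤ.+ t ℤ.- s
        lem = solve-∀

      -- Modulo `p`, both sides satisfy `s (n+2) = 2 A s (n+1) + 4 B s n` with the same first two
      -- values. The factors `2 ^ n` and `x` keep the formula free of division.
      binet : ∀ n → (A + x) ^ n - (A - x) ^ n ≈ (+ 2) ^ n * (x * E A B n)
      binet zero          = reflexive (lem x)
        where
        lem : ∀ x → 1ℤ ℤ.- 1ℤ ≡ 1ℤ ℤ.* (x ℤ.* 0ℤ)
        lem = solve-∀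
      binet (suc zero)    = reflexive (lem A x)
        where
        lem : ∀ A x → (A ℤ.+ x) ℤ.* 1ℤ ℤ.- (A ℤ.- x) ℤ.* 1ℤ ≡ (+ 2 ℤ.* 1ℤ) ℤ.* (x ℤ.* 1ℤ)
        lem = solve-∀
      binet (suc (suc n)) = begin
        a * (a * a ^ n) - b * (b * b ^ n)
          -- A difference of powers of `a` and `b` obeys the recurrence with coefficients `a + b`
          -- and `- a b`, here `2 A` and `x * x - A * A`.
          ≡⟨ lem A x (a ^ n) (b ^ n) ⟩
        (+ 2 * A) * (a * a ^ n - b * b ^ n) + (x * x - A * A) * (a ^ n - b ^ n)
          ≈⟨ +-cong (*-congˡ {+ 2 * A} (binet (suc n))) (*-cong (≈-sym 4B≈x²-A²) (binet n)) ⟩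
        (+ 2 * A) * (+ 2 * (+ 2) ^ n * (x * E A B (suc n))) + (+ 4 * B) * ((+ 2) ^ n * (x * E A B n))
          ≡⟨ lem′ A B x ((+ 2) ^ n) (E A B (suc n)) (E A B n) ⟩
        + 2 * (+ 2 * (+ 2) ^ n) * (x * (A * E A B (suc n) + B * E A B n)) ∎
        where
        a = A + x
        b = A - x
        lem : ∀ A x u v →
          (A ℤ.+ x) ℤ.* ((A ℤ.+ x) ℤ.* u) ℤ.- (A ℤ.- x) ℤ.* ((A ℤ.- x) ℤ.* v) ≡
          (+ 2 ℤ.* A) ℤ.* ((A ℤ.+ x) ℤ.* u ℤ.- (A ℤ.- x) ℤ.* v) ℤ.+ (x ℤ.* x ℤ.- A ℤ.* A) ℤ.* (u ℤ.- v)
        lem = solve-∀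
        lem′ : ∀ A B x t e f →
          (+ 2 ℤ.* A) ℤ.* (+ 2 ℤ.* t ℤ.* (x ℤ.* e)) ℤ.+ (+ 4 ℤ.* B) ℤ.* (t ℤ.* (x ℤ.* f)) ≡
          + 2 ℤ.* (+ 2 ℤ.* t) ℤ.* (x ℤ.* (A ℤ.* e ℤ.+ B ℤ.* f))
        lem′ = solve-∀

      module _ (2≉0 : ¬ + 2 ≈ 0#) (x≉0 : ¬ x ≈ 0#) (B≉0 : ¬ B ≈ 0#)
               {m : ℕ} (p≡1+m : p ≡ suc m) where

        -- The product is congruent to `- 4 B`, whose factors 2, 2 and `B` are all non-zero modulo
        -- `p`.
        [A+x][A-x]≉0 : ¬ (A + x) * (A - x) ≈ 0#
        [A+x][A-x]≉0 ab≈0 =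
          Sum.[ 2≉0 , (λ 2B≈0 → Sum.[ 2≉0 , B≉0 ]′ (zero-product (+ 2) B 2B≈0)) ]′
            (zero-product (+ 2) (+ 2 * B) 4B≈0)
          where
          lem : ∀ A x → x ℤ.* x ℤ.- A ℤ.* A ≡ ℤ.- ((A ℤ.+ x) ℤ.* (A ℤ.- x))
          lem = solve-∀
          4B≈0 : + 2 * (+ 2 * B) ≈ 0#
          4B≈0 = begin
            + 2 * (+ 2 * B)          ≡⟨ ℤ.*-assoc (+ 2) (+ 2) B ⟨
            + 4 * B                  ≈⟨ 4B≈x²-A² ⟩
            x * x - A * A            ≡⟨ lem A x ⟩
            - ((A + x) * (A - x))    ≈⟨ -‿cong {(A + x) * (A - x)} {0#} ab≈0 ⟩
            0#                       ∎

        A+x≉0 : ¬ A + x ≈ 0#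
        A+x≉0 a≈0 = [A+x][A-x]≉0 (≈-trans (*-congʳ {A - x} a≈0) (zeroˡ (A - x)))

        A-x≉0 : ¬ A - x ≈ 0#
        A-x≉0 b≈0 = [A+x][A-x]≉0 (≈-trans (*-congˡ {A + x} b≈0) (zeroʳ (A + x)))

        -- At exponent `p - 1` all three powers in `binet` are congruent to 1, which leaves
        -- `x * E A B m ≈ 1# - 1#`.
        E[p-1]≈0 : E A B m ≈ 0#
        E[p-1]≈0 = *-cancelˡ-≉0 x (E A B m) 0# x≉0 (begin
          x * E A B m                ≈⟨ *-identityˡ (x * E A B m) ⟨
          1# * (x * E A B m)         ≈⟨ *-congʳ {x * E A B m} (fermat-unit p≡1+m 2≉0) ⟨
          (+ 2) ^ m * (x * E A B m)    ≈⟨ binet m ⟨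
          (A + x) ^ m - (A - x) ^ m  ≈⟨ +-cong (fermat-unit p≡1+m A+x≉0) (-‿cong (fermat-unit p≡1+m A-x≉0)) ⟩
          0#                         ≈⟨ zeroʳ x ⟨
          x * 0#                     ∎)

        -- At exponent `p` each power in `binet` reduces to its base, so the right-hand factor
        -- `x * E A B p` is multiplied by 2 and equals `2 x`; then 2 and `x` are cancelled.
        E[p]≈1 : E A B p ≈ 1#
        E[p]≈1 = *-cancelˡ-≉0 x (E A B p) 1# x≉0
          (*-cancelˡ-≉0 (+ 2) (x * E A B p) (x * 1#) 2≉0 (begin
            + 2 * (x * E A B p)        ≈⟨ *-congʳ {x * E A B p} (fermat (+ 2)) ⟨
            (+ 2) ^ p * (x * E A B p)    ≈⟨ binet p ⟨
            (A + x) ^ p - (A - x) ^ p  ≈⟨ +-cong (fermat (A + x)) (-‿cong (fermat (A - x))) ⟩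
            (A + x) - (A - x)          ≡⟨ lem A x ⟩
            + 2 * (x * 1#)             ∎))
          where
          lem : ∀ A x → (A ℤ.+ x) ℤ.- (A ℤ.- x) ≡ + 2 ℤ.* (x ℤ.* 1ℤ)
          lem = solve-∀

  -- Odd primes, and the period as a divisor of p - 1.

  2≉0 : ¬ 2 ∣ p → ¬ + 2 ≈ 0#
  -- `p` would divide 2, hence be 1 or 2.
  2≉0 2∤p 2≈0 with prime⇒irreducible prime[2] (ℤ∣.∣⇒∣ᵤ (≈0⇒∣ 2≈0))
  ... | inj₁ refl = ¬prime[1] p-prime
  ... | inj₂ refl = 2∤p (divides 1 refl)

theorem6 : (p : ℕ) → Prime p → ¬ (2 ∣ p) →
    (A B : ℤ) → NonzeroQuadraticResidue (Δ A B) p →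
    (k : ℕ) → IsPeriod A B p k →
    k ∣ p ∸ 1 × k ≤ p ∸ 1
theorem6 zero p-prime = contradiction p-prime ¬prime[0]
theorem6 (suc zero) p-prime = contradiction p-prime ¬prime[1]
-- Two successors make `p ∸ 1` visibly positive, as the bound from `∣⇒≤` requires.
theorem6 p@(suc m@(suc _)) p-prime 2∤p A B (Δ≢0 , x , Δ≡x²) k (ret , least) =
  k∣p-1 , ∣⇒≤ k∣p-1
  where
  open CommutativeRing (ℤ/ p) using (_≈_; 0#; _*_; *-congʳ; zeroˡ; setoid)
  open import Relation.Binary.Reasoning.Setoid setoid
  Δ≈x² : Δ A B ≈ x * x
  Δ≈x² = congruent Δ≡x²
  x≉0 : ¬ x ≈ 0#
  x≉0 x≈0 = Δ≢0 (Congruent.difference (begin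
    Δ A B   ≈⟨ Δ≈x² ⟩
    x * x   ≈⟨ *-congʳ {x} x≈0 ⟩
    0# * x  ≈⟨ zeroˡ x ⟩
    0#      ∎))
  2≢0 = 2≉0 p-prime 2∤p
  B≉0 = return⇒B≉0 p-prime A B ret
  k∣p-1 : k ∣ m
  -- The index after `m` is `p` itself, so the terms at `p - 1` and `p` are exactly the pair to be
  -- checked.
  k∣p-1 = period-divides p-prime A B (ret , least) m
    (E[p-1]≈0 p-prime A B x Δ≈x² 2≢0 x≉0 B≉0 refl)
    (E[p]≈1 p-prime A B x Δ≈x² 2≢0 x≉0 B≉0 {m} refl)
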